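{- Let $G$ be a graph containing a vertex $v$ of degree at most $\chi(G)-1$. Then at least one of the following holds: (i) $G$ is recolorable; (ii) $G-v$ is not recolorable.
   Context: All graphs are finite and simple. A $k$-coloring of $G$ is a map $V(G)\to\{1,\dots,k\}$ giving adjacent vertices different values; $\chi(G)$ is the chromatic number. $R_k(G)$ denotes the graph whose vertices are the $k$-colorings of $G$, two being adjacent if they differ in color on exactly one vertex. $G$ is recolorable if $R_\ell(G)$ is connected for all $\ell\ge\chi(G)+1$. $G-v$ is the graph obtained from $G$ by deleting $v$. -}

module Defs where

open import Data.Fin.Base using (Fin; punchIn)
open import Data.Fin.Properties using (_≟_; any?; all?)
open import Data.List.Base using (length; filter)
import Data.List.Base as List
open import Data.Nat.Base using (ℕ; zero; suc; _≤_; z≤n; s≤s; _+_)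
open import Data.Product using (∃; ∃!; _×_; _,_; proj₁)
open import Data.Vec.Base using (Vec; []; _∷_; lookup; allFin)
open import Data.Vec.Properties using (lookup-allFin)
open import Function.Base using (_∘_)
open import Relation.Binary.Construct.Closure.ReflexiveTransitive using (Star)
open import Relation.Binary.Definitions using (Symmetric; Irreflexive) renaming (Decidable to Decidable₂)
open import Relation.Binary.PropositionalEquality using (_≡_; _≢_; refl; sym; trans)
open import Relation.Nullary using (Dec; yes; no; contradiction)
open import Relation.Nullary.Decidable using (map′; ¬?; _×-dec_; _→-dec_; recompute)
open import Relation.Unary using (Decidable)

-- Simple graphs on an arbitrary vertex type, so that the reconfiguration graph
-- is again a graph.  The finite graphs being coloured are those on Fin n.
record Graph (V : Set) : Set₁ where
  field
    Adj         : V → V → Set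
    adj?        : Decidable₂ Adj
    symmetric   : Symmetric Adj
    irreflexive : Irreflexive _≡_ Adj

open Graph public

Connected : ∀ {V} → Graph V → Set
Connected G = ∀ x y → Star (Adj G) x y

degree : ∀ {n} → Graph (Fin n) → Fin n → ℕ
degree G v = length (filter (adj? G v) (List.allFin _))

-- punchIn v : Fin n → Fin (suc n) is the injection whose image omits exactly v.
_-_ : ∀ {n} → Graph (Fin (suc n)) → Fin (suc n) → Graph (Fin n)
G - v = record
  { Adj         = λ i j → Adj G (punchIn v i) (punchIn v j)
  ; adj?        = λ i j → adj? G (punchIn v i) (punchIn v j)
  ; symmetric   = symmetric G
  ; irreflexive = λ { refl → irreflexive G refl }
  }

module _ {n : ℕ} (G : Graph (Fin n)) where

  Proper : ∀ {k} → Vec (Fin k) n → Set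
  Proper c = ∀ u w → Adj G u w → lookup c u ≢ lookup c w

  proper? : ∀ {k} → Decidable (Proper {k})
  proper? c = all? λ u → all? λ w →
    adj? G u w →-dec ¬? (lookup c u ≟ lookup c w)

  -- The map V(G) → {1,…,k} is stored as a vector and its properness is
  -- irrelevant, so that _≡_ on colorings is pointwise equality of maps
  -- (without function extensionality).
  record Coloring (k : ℕ) : Set where
    constructor coloring
    field
      colors  : Vec (Fin k) n
      .proper : Proper colors

    color : Fin n → Fin k
    color = lookup colors

  open Coloring public

DifferAtOneVertex : ∀ {n k} {G : Graph (Fin n)} → Coloring G k → Coloring G k → Set
DifferAtOneVertex c d = ∃! _≡_ λ u → color c u ≢ color d u

differAtOneVertex? : ∀ {n k} {G : Graph (Fin n)} →
                     Decidable₂ (DifferAtOneVertex {n} {k} {G})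
differAtOneVertex? c d =
  map′ (λ { (u , p , q) → u , p , λ {w} → q w })
       (λ { (u , p , q) → u , p , λ w → q {w} })
       (any? λ u → differ? u ×-dec all? λ w → differ? w →-dec (u ≟ w))
  where
  differ? : Decidable λ u → color c u ≢ color d u
  differ? u = ¬? (color c u ≟ color d u)

R : ∀ {n} (k : ℕ) (G : Graph (Fin n)) → Graph (Coloring G k)
R k G = record
  { Adj         = DifferAtOneVertex
  ; adj?        = differAtOneVertex?
  ; symmetric   = λ { (u , p , q) → u , p ∘ sym , λ r → q (r ∘ sym) }
  ; irreflexive = λ { refl (u , p , q) → p refl }
  }

IsLeast : (ℕ → Set) → ℕ → Set
IsLeast P k = P k × (∀ j → P j → k ≤ j)

least : ∀ {P : ℕ → Set} → Decidable P → ∀ n → P n → ∃ (IsLeast P)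
least P? n p with P? 0
least P? n       p | yes p₀ = 0 , p₀ , λ _ _ → z≤n
least P? zero    p | no ¬p₀ = contradiction p ¬p₀
least {P} P? (suc n) p | no ¬p₀ with least (P? ∘ suc) n p
... | k , pₖ , min = suc k , pₖ , λ
  { zero    p₀ → contradiction p₀ ¬p₀
  ; (suc j) pⱼ → s≤s (min j pⱼ)
  }

anyVec? : ∀ {n k} {P : Vec (Fin k) n → Set} → Decidable P → Dec (∃ P)
anyVec? {zero}  P? = map′ ([] ,_) (λ { ([] , p) → p }) (P? [])
anyVec? {suc n} P? =
  map′ (λ { (x , xs , p) → x ∷ xs , p })
       (λ { (x ∷ xs , p) → x , xs , p })
       (any? λ x → anyVec? λ xs → P? (x ∷ xs))

module _ {n : ℕ} (G : Graph (Fin n)) where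

  coloring? : ∀ k → Dec (Coloring G k)
  coloring? k =
    map′ (λ { (c , p) → coloring c p })
         (λ { (coloring c p) → c , recompute (proper? G c) p })
         (anyVec? (proper? G))

  injectiveColoring : Coloring G n
  injectiveColoring = coloring (allFin n) λ u w u~w eq →
    irreflexive G (trans (sym (lookup-allFin u)) (trans eq (lookup-allFin w))) u~w

  chromaticNumber : ∃ (IsLeast (Coloring G))
  chromaticNumber = least coloring? n injectiveColoring

  χ : ℕ
  χ = proj₁ chromaticNumber

  Recolorable : Set
  Recolorable = ∀ ℓ → χ + 1 ≤ ℓ → Connected (R ℓ G)

{-# OPTIONS --safe #-}

-- Given a path between two colorings of G - v, one can follow it in G: before
-- a step, move v to a color that neither end of the step uses on N(v).  At
-- most deg v + 1 colors are excluded, so deg v + 2 colors suffice, and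
-- ℓ ≥ χ(G) + 1 provides them.
--
-- Hence (G - v recolorable) implies (G recolorable).  The disjunction also
-- needs recolorability to be decidable: by the same extension argument
-- R ℓ G is always connected for ℓ ≥ n + 2, which leaves finitely many ℓ,
-- and connectedness of a finite graph is decidable.

module Submission where

open import Defs
open import Data.Empty using (⊥-elim-irr)
open import Data.Fin.Base using (Fin; zero; punchIn; punchOut)
open import Data.Fin.Properties
  using (_≟_; pigeonhole; ¬∀⟶∃¬; punchIn-punchOut; <-irrefl; nonZeroIndex)
open import Data.List.Base
  using (List; []; _∷_; map; filter; length; cartesianProductWith; concatMap)
import Data.List.Base as List
open import Data.List.Membership.DecPropositional using (_∈?_)
open import Data.List.Membership.Propositional using (_∈_; _∉_; lose)
open import Data.List.Membership.Propositional.Properties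
  using (∈-allFin; ∈-cartesianProductWith⁺; ∈-concatMap⁺; ∈-filter⁺; ∈-map⁺)
open import Data.List.Properties using (length-filter; length-map; length-tabulate)
open import Data.List.Relation.Unary.All using (all?) renaming (lookup to All-lookup; tabulate to All-tabulate)
open import Data.List.Relation.Unary.Any using (here; there; index)
open import Data.List.Relation.Unary.Any.Properties using (lookup-index)
open import Data.Nat.Base using (ℕ; zero; suc; _+_; _≤_; _<_; _∸_; s≤s; >-nonZero⁻¹)
open import Data.Nat.Properties
  using (_≤?_; _<?_; allUpTo?; ≤-reflexive; ≤-trans; ≮⇒≥; m≤n⇒m≤1+n;
         m≤o∸n⇒m+n≤o; +-monoˡ-≤; +-assoc; +-comm)
open import Data.Product using (∃; _×_; _,_; proj₁; proj₂)
open import Data.Sum.Base using (_⊎_; inj₁; inj₂)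
open import Data.Vec.Base using (Vec; []; _∷_; lookup; insertAt; removeAt)
open import Data.Vec.Properties
  using (≡-dec; insertAt-lookup; insertAt-punchIn; insertAt-removeAt)
open import Function.Base using (_∘_)
open import Relation.Binary.Construct.Closure.ReflexiveTransitive using (Star; ε; _◅_; _◅◅_)
open import Relation.Binary.Definitions using (DecidableEquality)
open import Relation.Binary.PropositionalEquality
  using (_≡_; _≢_; refl; sym; trans; cong; subst; subst₂)
open import Relation.Nullary using (Dec; yes; no; ¬_; contradiction; contradiction-irr)
open import Relation.Nullary.Decidable using (map′; _×-dec_; _⊎-dec_; _→-dec_)

-- Deciding connectedness of a finite graph.

-- Floyd–Warshall: the inner vertices of the path all lie in the list.
data PathVia {V : Set} (G : Graph V) : List V → V → V → Set where
  stop : ∀ {x} → PathVia G [] x x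
  edge : ∀ {x y} → Adj G x y → PathVia G [] x y
  skip : ∀ {z zs x y} → PathVia G zs x y → PathVia G (z ∷ zs) x y
  via  : ∀ {z zs x y} → PathVia G zs x z → PathVia G zs z y → PathVia G (z ∷ zs) x y

module _ {V : Set} (G : Graph V) where

  PathVia⇒Star : ∀ {zs x y} → PathVia G zs x y → Star (Adj G) x y
  PathVia⇒Star stop      = ε
  PathVia⇒Star (edge e)  = e ◅ ε
  PathVia⇒Star (skip p)  = PathVia⇒Star p
  PathVia⇒Star (via p q) = PathVia⇒Star p ◅◅ PathVia⇒Star q

  PathVia-refl : ∀ zs {x} → PathVia G zs x x
  PathVia-refl []       = stop
  PathVia-refl (z ∷ zs) = skip (PathVia-refl zs)

  PathVia-edge : ∀ zs {x y} → Adj G x y → PathVia G zs x y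
  PathVia-edge []       e = edge e
  PathVia-edge (z ∷ zs) e = skip (PathVia-edge zs e)

  -- `via` records one passage through the head of the list. Where the two halves pass through it
  -- more often, the closed walk between the first and last passage is cut out; that walk may
  -- contain `z` itself.
  PathVia-trans : ∀ {zs x y z} → z ∈ zs →
                  PathVia G zs x z → PathVia G zs z y → PathVia G zs x y
  PathVia-trans (here refl) (skip p)  (skip q)  = via p q
  PathVia-trans (here refl) (skip p)  (via _ q) = via p q
  PathVia-trans (here refl) (via p _) (skip q)  = via p q
  PathVia-trans (here refl) (via p _) (via _ q) = via p q
  PathVia-trans (there z∈)  (skip p)  (skip q)  = skip (PathVia-trans z∈ p q)
  PathVia-trans (there z∈)  (skip p)  (via q r) = via (PathVia-trans z∈ p q) r
  PathVia-trans (there z∈)  (via p q) (skip r)  = via p (PathVia-trans z∈ q r)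
  PathVia-trans (there z∈)  (via p _) (via _ r) = via p r

  module _ (_≟V_ : DecidableEquality V) where

    PathVia? : ∀ zs x y → Dec (PathVia G zs x y)
    PathVia? [] x y =
      map′ (λ { (inj₁ refl) → stop ; (inj₂ e) → edge e })
           (λ { stop → inj₁ refl ; (edge e) → inj₂ e })
           (x ≟V y ⊎-dec adj? G x y)
    PathVia? (z ∷ zs) x y =
      map′ (λ { (inj₁ p) → skip p ; (inj₂ (p , q)) → via p q })
           (λ { (skip p) → inj₁ p ; (via p q) → inj₂ (p , q) })
           (PathVia? zs x y ⊎-dec (PathVia? zs x z ×-dec PathVia? zs z y))

    -- Once `xs` lists every vertex, asking inner vertices to lie in `xs` is no restriction, so
    -- `PathVia? xs` decides reachability.
    connected? : ∀ xs → (∀ x → x ∈ xs) → Dec (Connected G)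
    connected? xs complete =
      map′ (λ all x y → PathVia⇒Star (All-lookup (All-lookup all (complete x)) (complete y)))
           (λ conn → All-tabulate λ {x} _ → All-tabulate λ {y} _ → fromStar (conn x y))
           (all? (λ x → all? (PathVia? xs x) xs) xs)
      where
      fromStar : ∀ {x y} → Star (Adj G) x y → PathVia G xs x y
      fromStar ε       = PathVia-refl xs
      fromStar (e ◅ p) = PathVia-trans (complete _) (PathVia-edge xs e) (fromStar p)

-- Enumerating the colorings.

allVecs : ∀ k n → List (Vec (Fin k) n)
allVecs k zero    = [] ∷ []
allVecs k (suc n) = cartesianProductWith _∷_ (List.allFin k) (allVecs k n)

∈-allVecs : ∀ {k n} (c : Vec (Fin k) n) → c ∈ allVecs k n
∈-allVecs []      = here refl
∈-allVecs (x ∷ c) = ∈-cartesianProductWith⁺ _∷_ (∈-allFin x) (∈-allVecs c)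

module _ {n k : ℕ} (G : Graph (Fin n)) where

  coloring-≡ : {c d : Coloring G k} → colors c ≡ colors d → c ≡ d
  coloring-≡ refl = refl

  _≟ᶜ_ : DecidableEquality (Coloring G k)
  c ≟ᶜ d = map′ coloring-≡ (cong colors) (≡-dec _≟_ (colors c) (colors d))

  -- Properness is irrelevant, so a vector underlies at most one coloring.
  coloringsOn : Vec (Fin k) n → List (Coloring G k)
  coloringsOn c with proper? G c
  ... | yes p = coloring c p ∷ []
  ... | no  _ = []

  ∈-coloringsOn : (c : Coloring G k) → c ∈ coloringsOn (colors c)
  ∈-coloringsOn (coloring c p) with proper? G c
  ... | yes _ = here refl
  ... | no ¬p = contradiction-irr p ¬p

  R-connected? : Dec (Connected (R k G))
  R-connected? = connected? (R k G) _≟ᶜ_ (concatMap coloringsOn (allVecs k n)) λ c →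
    ∈-concatMap⁺ coloringsOn (lose (∈-allVecs (colors c)) (∈-coloringsOn c))

-- Otherwise sending each color to its position in `xs` would be an injection from `Fin k` into a
-- smaller set.
∃∉ : ∀ {k} (xs : List (Fin k)) → length xs < k → ∃ λ x → x ∉ xs
∃∉ {k} xs short = ¬∀⟶∃¬ k (_∈ xs) (λ x → _∈?_ _≟_ x xs) λ all∈ →
  let i , j , i<j , eq = pigeonhole short (index ∘ all∈) in
  <-irrefl (trans (lookup-index (all∈ i))
                  (trans (cong (List.lookup xs) eq) (sym (lookup-index (all∈ j)))))
           i<j

-- Deleting a vertex and restoring it.

punchIn-elim : ∀ {n} (v : Fin (suc n)) (P : Fin (suc n) → Set) →
               P v → (∀ i → P (punchIn v i)) → ∀ w → P w
punchIn-elim v P pv pi w with v ≟ w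
... | yes refl = pv
... | no v≢w   = subst P (punchIn-punchOut v≢w) (pi (punchOut v≢w))

module _ {n k : ℕ} (G : Graph (Fin (suc n))) (v : Fin (suc n)) where

  removeAt-punchIn : (c : Vec (Fin k) (suc n)) (i : Fin n) →
                     lookup (removeAt c v) i ≡ lookup c (punchIn v i)
  removeAt-punchIn c i =
    trans (sym (insertAt-punchIn (removeAt c v) v (lookup c v) i))
          (cong (λ d → lookup d (punchIn v i)) (insertAt-removeAt c v))

  restrict : Coloring G k → Coloring (G - v) k
  restrict (coloring c p) = coloring (removeAt c v) λ u w u~w eq →
    p _ _ u~w (trans (sym (removeAt-punchIn c u)) (trans eq (removeAt-punchIn c w)))

  Free : Coloring (G - v) k → Fin k → Set
  Free e a = ∀ i → Adj G v (punchIn v i) → color e i ≢ a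

  -- Freeness is irrelevant, so an extension depends only on `e` and `a`, and paths can be glued
  -- whatever freeness proofs their ends carry.
  extend : (e : Coloring (G - v) k) (a : Fin k) → .(Free e a) → Coloring G k
  extend (coloring e p) a free = coloring (insertAt e v a)
    (punchIn-elim v (λ u → ∀ w → Adj G u w → lookup c u ≢ lookup c w)
      (punchIn-elim v (λ w → Adj G v w → lookup c v ≢ lookup c w)
        (λ v~v _ → irreflexive G refl v~v)
        (λ i v~i eq → free i v~i (trans (sym (old i)) (trans (sym eq) new))))
      λ i → punchIn-elim v (λ w → Adj G (punchIn v i) w → lookup c (punchIn v i) ≢ lookup c w)
        (λ i~v eq → free i (symmetric G i~v) (trans (sym (old i)) (trans eq new)))
        (λ j i~j eq → p i j i~j (trans (sym (old i)) (trans eq (old j)))))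
    where
    c   = insertAt e v a
    new = insertAt-lookup e v a
    old = insertAt-punchIn e v a

  restrict-free : (c : Coloring G k) → Free (restrict c) (color c v)
  restrict-free (coloring c p) i v~i eq =
    -- `p` is available only irrelevantly, which suffices for deriving a contradiction.
    ⊥-elim-irr (p _ _ v~i (sym (trans (sym (removeAt-punchIn c i)) eq)))

  extend-restrict : (c : Coloring G k) →
                    extend (restrict c) (color c v) (restrict-free c) ≡ c
  extend-restrict c = coloring-≡ G (insertAt-removeAt (colors c) v)

  -- The extensions can differ only at `v`. Equal colors require the empty path, as adjacency in
  -- `R k G` demands a difference.
  recolor-v : ∀ e {a b} .(free-a : Free e a) .(free-b : Free e b) →
              Star (Adj (R k G)) (extend e a free-a) (extend e b free-b)
  recolor-v e {a} {b} _ _ with a ≟ b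
  ... | yes refl = ε
  ... | no a≢b   =
    (v , (λ eq → a≢b (trans (sym (insertAt-lookup (colors e) v a))
                            (trans eq (insertAt-lookup (colors e) v b))))
       , λ {w} → punchIn-elim v
           (λ w → lookup (insertAt (colors e) v a) w ≢ lookup (insertAt (colors e) v b) w → v ≡ w)
           (λ _ → refl)
           (λ i ne → contradiction
             (trans (insertAt-punchIn (colors e) v a i)
                    (sym (insertAt-punchIn (colors e) v b i))) ne)
           w)
    ◅ ε

  extend-step : ∀ e f a .(free-e : Free e a) .(free-f : Free f a) →
                Adj (R k (G - v)) e f →
                Adj (R k G) (extend e a free-e) (extend f a free-f)
  extend-step e f a _ _ (u , differ , unique) =
    punchIn v u
    , (λ eq → differ (trans (sym (old e u)) (trans eq (old f u))))
    , λ {w} → punchIn-elim v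
        (λ w → lookup (insertAt (colors e) v a) w ≢ lookup (insertAt (colors f) v a) w →
               punchIn v u ≡ w)
        (λ ne → contradiction
          (trans (insertAt-lookup (colors e) v a) (sym (insertAt-lookup (colors f) v a))) ne)
        (λ i ne → cong (punchIn v)
          (unique λ eq → ne (trans (old e i) (trans eq (sym (old f i))))))
        w
    where
    old : (e : Coloring (G - v) k) → ∀ i →
          lookup (insertAt (colors e) v a) (punchIn v i) ≡ color e i
    old e = insertAt-punchIn (colors e) v a

  -- Lifting paths from the deletion.

  module _ (enough : degree G v + 2 ≤ k) where

    -- f agrees with e except at u, so the colors of N(v) in e together with
    -- the color of u in f cover the colors of N(v) in both.
    common-free : Fin k → ∀ e f → Adj (R k (G - v)) e f → ∃ λ a → Free e a × Free f a
    common-free d e f (u , _ , unique) = a , free-e , free-f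
      where
      neighbours = filter (adj? G v) (List.allFin (suc n))
      -- `d` is a default color at `v`, making `e` a map on all vertices of `G`; `v` is not among
      -- its own neighbours.
      e⁺         = lookup (insertAt (colors e) v d)
      used       = color f u ∷ map e⁺ neighbours

      -- In `2 +`, one unit counts `color f u` and the other comes from the strict inequality.
      short : length used < k
      short = ≤-trans (≤-reflexive (trans (cong (2 +_) (length-map e⁺ neighbours))
                                          (+-comm 2 (degree G v))))
                      enough

      unused : ∃ λ a → a ∉ used
      unused = ∃∉ used short

      a = proj₁ unused

      free-e : Free e a
      free-e i v~i eq = proj₂ unused (there
        (subst (_∈ map e⁺ neighbours) (trans (insertAt-punchIn (colors e) v d i) eq)
          (∈-map⁺ e⁺ (∈-filter⁺ (adj? G v) (∈-allFin _) v~i))))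

      free-f : Free f a
      free-f i v~i eq with color e i ≟ color f i
      ... | yes same = free-e i v~i (trans same eq)
      -- Here `i` is `u`, whose color in `f` is the head of `used`.
      ... | no  diff with refl ← unique diff = proj₂ unused (here (sym eq))

    extend-path : ∀ {e f a b} .(free-a : Free e a) .(free-b : Free f b) →
                  Star (Adj (R k (G - v))) e f →
                  Star (Adj (R k G)) (extend e a free-a) (extend f b free-b)
    -- At the end of the path only the color of `v` remains to be corrected.
    extend-path {e} free-a free-b ε = recolor-v e free-a free-b
    extend-path {e} {a = a} free-a free-b (_◅_ {j = g} e~g path) =
      let x , free-e , free-g = common-free a e g e~g in
      recolor-v e free-a free-e ◅◅
      extend-step e g x free-e free-g e~g ◅ extend-path free-g free-b path

    R-connected-from-deletion : Connected (R k (G - v)) → Connected (R k G)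
    R-connected-from-deletion conn c d =
      subst₂ (Star (Adj (R k G))) (extend-restrict c) (extend-restrict d)
        (extend-path (restrict-free c) (restrict-free d) (conn (restrict c) (restrict d)))

-- Decidability of recolorability.

degree≤n : ∀ {n} (G : Graph (Fin n)) v → degree G v ≤ n
degree≤n G v = ≤-trans (length-filter (adj? G v) (List.allFin _))
                       (≤-reflexive (length-tabulate (λ i → i)))

-- Induction deleting vertex `zero`; the crude bound `degree≤n` leads to the threshold `n + 2`.
R-connected-many-colors : ∀ {n ℓ} (G : Graph (Fin n)) → n + 2 ≤ ℓ → Connected (R ℓ G)
R-connected-many-colors {zero}  G _ (coloring [] _) (coloring [] _) = ε
R-connected-many-colors {suc n} G (s≤s n+2≤ℓ) =
  R-connected-from-deletion G zero
    (≤-trans (+-monoˡ-≤ 2 (degree≤n G zero)) (s≤s n+2≤ℓ))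
    (R-connected-many-colors (G - zero) (m≤n⇒m≤1+n n+2≤ℓ))

recolorable? : ∀ {n} (G : Graph (Fin n)) → Dec (Recolorable G)
recolorable? {n} G =
  map′ all-ℓ (λ rec {ℓ} _ → rec ℓ)
    (allUpTo? (λ ℓ → (χ G + 1 ≤? ℓ) →-dec R-connected? G) (n + 2))
  where
  all-ℓ : (∀ {ℓ} → ℓ < n + 2 → χ G + 1 ≤ ℓ → Connected (R ℓ G)) → Recolorable G
  all-ℓ few ℓ χ<ℓ with ℓ <? n + 2
  ... | yes ℓ<n+2 = few ℓ<n+2 χ<ℓ
  ... | no  ℓ≮n+2 = R-connected-many-colors G (≮⇒≥ ℓ≮n+2)

-- Chromatic numbers and the degree condition.

optimalColoring : ∀ {n} (G : Graph (Fin n)) → Coloring G (χ G)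
optimalColoring G = proj₁ (proj₂ (chromaticNumber G))

-- An optimal coloring of `G` restricts to `G - v`.
χ-deletion : ∀ {n} (G : Graph (Fin (suc n))) v → χ (G - v) ≤ χ G
χ-deletion G v = proj₂ (proj₂ (chromaticNumber (G - v))) (χ G) (restrict G v (optimalColoring G))

-- The color of vertex `zero` inhabits `Fin (χ G)`. Positivity makes the truncated `χ G ∸ 1` a true
-- subtraction.
χ-positive : ∀ {n} (G : Graph (Fin (suc n))) → 1 ≤ χ G
χ-positive G = >-nonZero⁻¹ (χ G) ⦃ nonZeroIndex (color (optimalColoring G) zero) ⦄

recolorable-from-deletion : ∀ {n} (G : Graph (Fin (suc n))) v → degree G v ≤ χ G ∸ 1 →
                            Recolorable (G - v) → Recolorable G
recolorable-from-deletion G v deg rec ℓ χ<ℓ =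
  R-connected-from-deletion G v
    -- The chain is `degree G v + 2 ≤ χ G + 1 ≤ ℓ`.
    (≤-trans (≤-reflexive (sym (+-assoc (degree G v) 1 1)))
      (≤-trans (+-monoˡ-≤ 1 (m≤o∸n⇒m+n≤o (degree G v) (χ-positive G) deg)) χ<ℓ))
    -- Since `χ (G - v) ≤ χ G`, this `ℓ` is in the range covered by `rec`.
    (rec ℓ (≤-trans (+-monoˡ-≤ 1 (χ-deletion G v)) χ<ℓ))

lemma2 : ∀ {n : ℕ} (G : Graph (Fin (suc n))) (v : Fin (suc n)) →
    degree G v ≤ χ G ∸ 1 →
    Recolorable G ⊎ ¬ Recolorable (G - v)
lemma2 G v deg with recolorable? (G - v)
... | yes rec = inj₁ (recolorable-from-deletion G v deg rec)
... | no ¬rec = inj₂ ¬rec
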